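{- Let $q$ be a prime power, $n\ge3$, $\sigma$ a generator of $\mathrm{Gal}(\mathbb{F}_{q^n}/\mathbb{F}_q)$, and $L=ax+bx^{\sigma}+cx^{\sigma^2}+dx^{\sigma^3}$ with $a,b,c,d\in\mathbb{F}_{q^n}$ and $abcd\neq0$. Then $L$ has $q^3$ roots in $\mathbb{F}_{q^n}$ if and only if $H_{n-1}=H_{n-2}=0$ and $H_nN(c/d)=1$.
   Context: $N(x)=x^{1+\sigma+\dots+\sigma^{n-1}}$ is the norm $\mathbb{F}_{q^n}\to\mathbb{F}_q$. Let $w=\frac{a^\sigma c}{b^{\sigma+1}}$ and $z=\frac{b^\sigma d}{c^{\sigma+1}}$. Define $H_0=1$, $H_1=-1$, $H_2=1-z$, and for $k\ge3$, $H_k=-H_{k-1}-z^{\sigma^{k-2}}H_{k-2}-w^{\sigma^{k-2}}z^{\sigma^{k-2}+\sigma^{k-3}}H_{k-3}$. -}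

module Defs where

open import Level using (Level; _⊔_)
open import Data.Nat as ℕ using (ℕ; zero; suc; _<_; _≤_)
open import Data.Nat.Primality using (Prime)
open import Data.Fin using (Fin)
import Data.Fin as Fin
open import Data.Product using (Σ; ∃; _×_; _,_)
open import Relation.Nullary using (¬_; yes; no)
open import Relation.Binary using (Decidable)
open import Relation.Binary.PropositionalEquality using (_≡_)
open import Algebra.Bundles using (CommutativeRing)

IsPrimePower : ℕ → Set
IsPrimePower q = Σ ℕ λ p → Σ ℕ λ k → Prime p × 1 ≤ k × q ≡ p ℕ.^ k

iter : ∀ {a} {A : Set a} → ℕ → (A → A) → A → A
iter zero    f x = x
iter (suc m) f x = f (iter m f x)

module _ {r ℓ : Level} (R : CommutativeRing r ℓ) where
  open CommutativeRing R

  pow : Carrier → ℕ → Carrier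
  pow x zero    = 1#
  pow x (suc m) = x * pow x m

  record IsField : Set (r ⊔ ℓ) where
    field
      _⁻¹      : Carrier → Carrier
      ⁻¹-cong  : ∀ {x y} → x ≈ y → x ⁻¹ ≈ y ⁻¹
      inverseʳ : ∀ x → ¬ (x ≈ 0#) → x * (x ⁻¹) ≈ 1#
      0≉1      : ¬ (0# ≈ 1#)

  record HasCardinality (N : ℕ) : Set (r ⊔ ℓ) where
    field
      enum       : Fin N → Carrier
      enum-inj   : ∀ i j → enum i ≈ enum j → i ≡ j
      enum-surj  : ∀ x → ∃ λ i → enum i ≈ x

  countFin : ∀ {p} {P : Carrier → Set p} → (∀ x → Relation.Nullary.Dec (P x)) →
             (N : ℕ) → (Fin N → Carrier) → ℕ
  countFin P? zero    f = 0
  countFin P? (suc N) f with P? (f Fin.zero)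
  ... | yes _ = suc (countFin P? N (λ i → f (Fin.suc i)))
  ... | no  _ = countFin P? N (λ i → f (Fin.suc i))

  record IsAutomorphism (σ : Carrier → Carrier) : Set (r ⊔ ℓ) where
    field
      σ-cong  : ∀ {x y} → x ≈ y → σ x ≈ σ y
      σ-+     : ∀ x y → σ (x + y) ≈ σ x + σ y
      σ-*     : ∀ x y → σ (x * y) ≈ σ x * σ y
      σ-1     : σ 1# ≈ 1#
      σ-inj   : ∀ x y → σ x ≈ σ y → x ≈ y
      σ-surj  : ∀ y → ∃ λ x → σ x ≈ y

  -- σ is a generator of Gal(F_{q^n}/F_q), where F_q = {x | x^q = x} ⊆ R:
  -- σ is an automorphism fixing F_q pointwise, and σ has order exactly n
  -- (Gal(F_{q^n}/F_q) is cyclic of order n).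
  record IsGaloisGenerator (q n : ℕ) (σ : Carrier → Carrier) : Set (r ⊔ ℓ) where
    field
      automorphism : IsAutomorphism σ
      fixes-Fq     : ∀ x → pow x q ≈ x → σ x ≈ x
      order-n      : ∀ x → iter n σ x ≈ x
      order-exact  : ∀ k → 0 < k → k < n → ¬ (∀ x → iter k σ x ≈ x)

  module Quadrinomial (_⁻¹ : Carrier → Carrier) (σ : Carrier → Carrier)
                      (a b c d : Carrier) where
    _/_ : Carrier → Carrier → Carrier
    x / y = x * (y ⁻¹)

    σ^ : ℕ → Carrier → Carrier
    σ^ i x = iter i σ x

    L : Carrier → Carrier
    L x = a * x + b * σ^ 1 x + c * σ^ 2 x + d * σ^ 3 x

    Norm : ℕ → Carrier → Carrier
    Norm n x = prod n
      where
        prod : ℕ → Carrier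
        prod zero    = 1#
        prod (suc i) = prod i * σ^ i x

    w : Carrier
    w = (σ a * c) / (σ b * b)

    z : Carrier
    z = (σ b * d) / (σ c * c)

    H : ℕ → Carrier
    H zero = 1#
    H (suc zero) = - 1#
    H (suc (suc zero)) = 1# + (- z)
    H (suc (suc (suc k))) =
      (- H (suc (suc k)))
      + (- (σ^ (suc k) z * H (suc k)))
      + (- (σ^ (suc k) w * (σ^ (suc k) z * σ^ k z) * H k))

{-# OPTIONS --safe #-}
-- Modulo right division by L, σᵏ reduces to A k + B k σ + C k σ², and C (k + 2) is
-- H k times the k-th partial norm of c/d; hence the conditions on H say exactly that
-- σⁿ - 1 is right divisible by L.  A nonzero operator p₀ + p₁σ + ⋯ + pₘσᵐ has at most qᵐ
-- roots.  If L has q³ roots, the remainder of σⁿ - 1, of degree at most 2, is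
-- therefore zero; conversely, if σⁿ - 1 = P L, then P has at most qⁿ⁻³ roots and
-- contains the image of L among them, so that L has at least q³ roots.
--
-- The root bound is by dividing by σ - α for α = σ(u)/u at a root u ≠ 0, and needs
-- that the fixed field of σ, of order Q, has at most q elements.  By Dedekind's
-- independence of 1, σ, …, σⁿ⁻¹, factors σ - α can be multiplied n times so that the
-- kernel grows by a factor Q each time; hence Qⁿ ≤ qⁿ.

module Submission where

open import Defs
open import Level using (Level; _⊔_)
open import Data.Nat as ℕ using (ℕ; zero; suc; _≤_; _<_; _^_; _∸_; z≤n; s≤s)
import Data.Nat.Properties as ℕₚ
open import Data.Nat.Primality using (prime⇒nonTrivial)
open import Data.Fin as Fin using (Fin)
import Data.Fin.Properties as Finₚ
open import Data.Product using (∃; Σ; _×_; _,_; proj₁; proj₂)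
open import Data.Unit using (⊤; tt)
open import Function.Base using (_∘_)
open import Function.Bundles using (_⇔_; mk⇔)
open import Relation.Nullary using (¬_; Dec; yes; no; ¬?; _×-dec_; contradiction)
open import Relation.Binary using (Decidable; _Respects_)
import Relation.Unary as U
open import Relation.Binary.PropositionalEquality as ≡ using (_≡_)
open import Algebra.Bundles using (CommutativeRing)
open import Algebra.Properties.CommutativeMonoid.Sum ℕₚ.+-0-commutativeMonoid
  using (sum; ∑-comm; sum-cong-≗)
open import Algebra.Properties.Semiring.Sum ℕₚ.+-*-semiring using (*-distribˡ-sum)
import Algebra.Properties.Ring
import Algebra.Solver.Ring.NaturalCoefficients.Default
import Relation.Binary.Reasoning.Setoid

-- Sums of indicators over finite index sets.

ind : ∀ {p} {P : Set p} → Dec P → ℕ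
ind (yes _) = 1
ind (no _)  = 0

ind-≤1 : ∀ {p} {P : Set p} (P? : Dec P) → ind P? ≤ 1
ind-≤1 (yes _) = ℕₚ.≤-refl
ind-≤1 (no _)  = z≤n

ind-mono : ∀ {p s} {P : Set p} {S : Set s} (P? : Dec P) (S? : Dec S) →
           (P → S) → ind P? ≤ ind S?
ind-mono (no _)  _       f = z≤n
ind-mono (yes p) (yes _) f = ℕₚ.≤-refl
ind-mono (yes p) (no ¬s) f = contradiction (f p) ¬s

ind-× : ∀ {p s} {P : Set p} {S : Set s} (P? : Dec P) (S? : Dec S) →
        ind (P? ×-dec S?) ≡ ind P? ℕ.* ind S?
ind-× (no _)  _       = ≡.refl
ind-× (yes _) (yes _) = ≡.refl
ind-× (yes _) (no _)  = ≡.refl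

sum-mono : ∀ {m} {f g : Fin m → ℕ} → (∀ i → f i ≤ g i) → sum f ≤ sum g
sum-mono {zero}  f≤g = z≤n
sum-mono {suc m} f≤g = ℕₚ.+-mono-≤ (f≤g Fin.zero) (sum-mono (f≤g ∘ Fin.suc))

module _ {p : Level} where

  sum-ind-none : ∀ {m} {P : Fin m → Set p} (P? : U.Decidable P) →
                 (∀ i → ¬ P i) → sum (ind ∘ P?) ≡ 0
  sum-ind-none {zero}  P? ¬P = ≡.refl
  sum-ind-none {suc m} P? ¬P with P? Fin.zero
  ... | yes p = contradiction p (¬P Fin.zero)
  ... | no  _ = sum-ind-none (P? ∘ Fin.suc) (¬P ∘ Fin.suc)

  sum-ind-≤1 : ∀ {m} {P : Fin m → Set p} (P? : U.Decidable P) →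
               (∀ i j → P i → P j → i ≡ j) → sum (ind ∘ P?) ≤ 1
  sum-ind-≤1 {zero}  P? uniq = z≤n
  sum-ind-≤1 {suc m} P? uniq with P? Fin.zero
  ... | yes p = ℕₚ.≤-reflexive (≡.cong suc (sum-ind-none (P? ∘ Fin.suc)
                  λ i pᵢ → Finₚ.0≢1+n (uniq Fin.zero (Fin.suc i) p pᵢ)))
  ... | no  _ = sum-ind-≤1 (P? ∘ Fin.suc)
                  λ i j pᵢ pⱼ → Finₚ.suc-injective (uniq _ _ pᵢ pⱼ)

  sum-ind-≥1 : ∀ {m} {P : Fin m → Set p} (P? : U.Decidable P) →
               ∀ i → P i → 1 ≤ sum (ind ∘ P?)
  sum-ind-≥1 P? Fin.zero    pᵢ with P? Fin.zero
  ... | yes _ = s≤s z≤n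
  ... | no ¬p = contradiction pᵢ ¬p
  sum-ind-≥1 P? (Fin.suc i) pᵢ =
    ℕₚ.≤-trans (sum-ind-≥1 (P? ∘ Fin.suc) i pᵢ) (ℕₚ.m≤n+m _ (ind (P? Fin.zero)))

  sum-ind-≤ : ∀ {m} {P : Fin m → Set p} (P? : U.Decidable P) → sum (ind ∘ P?) ≤ m
  sum-ind-≤ {zero}  P? = z≤n
  sum-ind-≤ {suc m} P? = ℕₚ.+-mono-≤ (ind-≤1 (P? Fin.zero)) (sum-ind-≤ (P? ∘ Fin.suc))

  sum-ind-all : ∀ {m} {P : Fin m → Set p} (P? : U.Decidable P) →
                (∀ i → P i) → m ≤ sum (ind ∘ P?)
  sum-ind-all {zero}  P? all = z≤n
  sum-ind-all {suc m} P? all with P? Fin.zero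
  ... | yes _ = s≤s (sum-ind-all (P? ∘ Fin.suc) (all ∘ Fin.suc))
  ... | no ¬p = contradiction (all Fin.zero) ¬p

-- Counting in a finite ring by fibres and kernels.

module Counting {r ℓ : Level} (R : CommutativeRing r ℓ)
                (_≟_ : Decidable (CommutativeRing._≈_ R))
                {N : ℕ} (card : HasCardinality R N) where
  open CommutativeRing R
  open HasCardinality card
  open Algebra.Properties.Ring ring using (+-cancelʳ; +-identityˡ-unique)

  # : ∀ {p} {P : Carrier → Set p} → U.Decidable P → ℕ
  # P? = sum (λ i → ind (P? (enum i)))

  countFin≡sum : ∀ {p} {P : Carrier → Set p} (P? : U.Decidable P) m (f : Fin m → Carrier) →
                 countFin R P? m f ≡ sum (λ i → ind (P? (f i)))
  countFin≡sum P? zero    f = ≡.refl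
  countFin≡sum P? (suc m) f with P? (f Fin.zero)
  ... | yes _ = ≡.cong suc (countFin≡sum P? m (f ∘ Fin.suc))
  ... | no  _ = countFin≡sum P? m (f ∘ Fin.suc)

  ∃? : ∀ {p} {P : Carrier → Set p} → P Respects _≈_ → U.Decidable P → Dec (∃ P)
  ∃? resp P? with Finₚ.any? (P? ∘ enum)
  ... | yes (i , pᵢ) = yes (enum i , pᵢ)
  ... | no ¬∃ = no λ (x , px) →
    ¬∃ (proj₁ (enum-surj x) , resp (sym (proj₂ (enum-surj x))) px)

  #-unique : ∀ {p} {P : Carrier → Set p} (P? : U.Decidable P) →
             (∀ x y → P x → P y → x ≈ y) → # P? ≤ 1
  #-unique P? uniq = sum-ind-≤1 (P? ∘ enum)
    λ i j pᵢ pⱼ → enum-inj i j (uniq _ _ pᵢ pⱼ)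

  #-inhabited : ∀ {p} {P : Carrier → Set p} (P? : U.Decidable P) → P Respects _≈_ →
                ∀ x → P x → 1 ≤ # P?
  #-inhabited P? resp x px = sum-ind-≥1 (P? ∘ enum) (proj₁ (enum-surj x))
    (resp (sym (proj₂ (enum-surj x))) px)

  #-≤ : ∀ {p} {P : Carrier → Set p} (P? : U.Decidable P) → # P? ≤ N
  #-≤ P? = sum-ind-≤ (P? ∘ enum)

  #-all : ∀ {p} {P : Carrier → Set p} (P? : U.Decidable P) → (∀ x → P x) → N ≤ # P?
  #-all P? all = sum-ind-all (P? ∘ enum) (all ∘ enum)

  #-mono : ∀ {p s} {P : Carrier → Set p} {S : Carrier → Set s}
           (P? : U.Decidable P) (S? : U.Decidable S) → (∀ x → P x → S x) → # P? ≤ # S?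
  #-mono P? S? P⊆S = sum-mono λ i → ind-mono (P? (enum i)) (S? (enum i)) (P⊆S (enum i))

  module _ {s t : Level} {S : Carrier → Set s} {T : Carrier → Set t}
           (S? : U.Decidable S) (T? : U.Decidable T) (T-resp : T Respects _≈_)
           (f : Carrier → Carrier) where

    fibre? : ∀ y → U.Decidable (λ x → S x × f x ≈ y)
    fibre? y x = S? x ×-dec (f x ≟ y)

    -- Double counting: since `enum` is a bijection up to `≈`, `f x` equals `enum j` for exactly one
    -- `j`. The indicator of `S x` can therefore be spread over all `j`, and the two sums exchanged.
    #-fibres : # S? ≡ sum (λ j → # (fibre? (enum j)))
    #-fibres = ≡.trans (sum-cong-≗ pointwise) (∑-comm λ i j → ind (fibre? (enum j) (enum i)))
      where
      one : ∀ x → sum (λ j → ind (f x ≟ enum j)) ≡ 1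
      one x = ℕₚ.≤-antisym
        (sum-ind-≤1 (λ j → f x ≟ enum j) λ i j p q → enum-inj i j (trans (sym p) q))
        (sum-ind-≥1 (λ j → f x ≟ enum j) (proj₁ (enum-surj (f x)))
          (sym (proj₂ (enum-surj (f x)))))

      pointwise : ∀ i → ind (S? (enum i)) ≡ sum (λ j → ind (fibre? (enum j) (enum i)))
      pointwise i = begin
        ind (S? x)                                ≡⟨ ℕₚ.*-identityʳ _ ⟨
        ind (S? x) ℕ.* 1                          ≡⟨ ≡.cong (ind (S? x) ℕ.*_) (one x) ⟨
        ind (S? x) ℕ.* sum (λ j → ind (f x ≟ enum j))
          ≡⟨ *-distribˡ-sum (ind (S? x)) (λ j → ind (f x ≟ enum j)) ⟩
        sum (λ j → ind (S? x) ℕ.* ind (f x ≟ enum j))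
          ≡⟨ sum-cong-≗ (λ j → ind-× (S? x) (f x ≟ enum j)) ⟨
        sum (λ j → ind (fibre? (enum j) x))       ∎
        where
        open ≡.≡-Reasoning
        x = enum i

    #-fibres-≤ : ∀ k → (∀ x → S x → T (f x)) → (∀ y → T y → # (fibre? y) ≤ k) →
                 # S? ≤ k ℕ.* # T?
    #-fibres-≤ k S⊆f⁻¹T bound = begin
      # S?                                  ≡⟨ #-fibres ⟩
      sum (λ j → # (fibre? (enum j)))       ≤⟨ sum-mono (λ j → at (enum j) (T? (enum j))) ⟩
      sum (λ j → k ℕ.* ind (T? (enum j)))   ≡⟨ *-distribˡ-sum k (λ j → ind (T? (enum j))) ⟨
      k ℕ.* # T?                            ∎
      where
      open ℕₚ.≤-Reasoning
      at : ∀ y (d : Dec (T y)) → # (fibre? y) ≤ k ℕ.* ind d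
      at y (yes ty) = ≡.subst (# (fibre? y) ≤_) (≡.sym (ℕₚ.*-identityʳ k)) (bound y ty)
      at y (no ¬ty) = ℕₚ.≤-trans (ℕₚ.≤-reflexive (sum-ind-none (fibre? y ∘ enum)
        λ i (si , e) → ¬ty (T-resp e (S⊆f⁻¹T _ si)))) z≤n

    #-fibres-≥ : ∀ k → (∀ y → T y → k ≤ # (fibre? y)) → k ℕ.* # T? ≤ # S?
    #-fibres-≥ k bound = begin
      k ℕ.* # T?                            ≡⟨ *-distribˡ-sum k (λ j → ind (T? (enum j))) ⟩
      sum (λ j → k ℕ.* ind (T? (enum j)))   ≤⟨ sum-mono (λ j → at (enum j) (T? (enum j))) ⟩
      sum (λ j → # (fibre? (enum j)))       ≡⟨ #-fibres ⟨
      # S?                                  ∎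
      where
      open ℕₚ.≤-Reasoning
      at : ∀ y (d : Dec (T y)) → k ℕ.* ind d ≤ # (fibre? y)
      at y (yes ty) = ≡.subst (_≤ # (fibre? y)) (≡.sym (ℕₚ.*-identityʳ k)) (bound y ty)
      at y (no ¬ty) = ≡.subst (_≤ # (fibre? y)) (≡.sym (ℕₚ.*-zeroʳ k)) z≤n

    #-injective : (∀ x → S x → T (f x)) → (∀ x y → f x ≈ f y → x ≈ y) → # S? ≤ # T?
    #-injective S⊆f⁻¹T inj = ℕₚ.≤-trans
      (#-fibres-≤ 1 S⊆f⁻¹T λ y _ → #-unique (fibre? y)
        λ x x′ (_ , e) (_ , e′) → inj x x′ (trans e (sym e′)))
      (ℕₚ.≤-reflexive (ℕₚ.*-identityˡ _))

  record IsAdditive (f : Carrier → Carrier) : Set (r ⊔ ℓ) where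
    field
      f-cong : ∀ {x y} → x ≈ y → f x ≈ f y
      f-+    : ∀ x y → f (x + y) ≈ f x + f y

  ker? : (f : Carrier → Carrier) → U.Decidable (λ x → f x ≈ 0#)
  ker? f x = f x ≟ 0#

  module _ {f : Carrier → Carrier} (f-additive : IsAdditive f) where
    open IsAdditive f-additive

    ker-resp : (λ x → f x ≈ 0#) Respects _≈_
    ker-resp x≈y fx≈0 = trans (f-cong (sym x≈y)) fx≈0

    module _ {s t : Level} {S : Carrier → Set s} {T : Carrier → Set t}
             (S? : U.Decidable S) (T? : U.Decidable T) (T-resp : T Respects _≈_) where

      -- Subtracting one of its points moves a nonempty fibre of `f` on `S` into the kernel, so no
      -- fibre is larger than the kernel. With `f` equal to `σ - α` this serves the upper bound on
      -- roots; with `f` equal to `L` it gives a lower bound for the kernel of `L`.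
      #-ker-≤ : (∀ x → S x → T (f x)) → # S? ≤ # (ker? f) ℕ.* # T?
      #-ker-≤ S⊆f⁻¹T = #-fibres-≤ S? T? T-resp f (# (ker? f)) S⊆f⁻¹T λ y _ → bound y
        where
        fib : ∀ y → U.Decidable (λ x → S x × f x ≈ y)
        fib = fibre? S? T? T-resp f

        bound : ∀ y → # (fib y) ≤ # (ker? f)
        bound y = cases (Finₚ.any? (fib y ∘ enum))
          where
          cases : Dec (∃ λ i → S (enum i) × f (enum i) ≈ y) → # (fib y) ≤ # (ker? f)
          cases (no ¬∃) = ℕₚ.≤-trans (ℕₚ.≤-reflexive (sum-ind-none (fib y ∘ enum)
            λ i p → ¬∃ (i , p))) z≤n
          cases (yes (i , _ , fx₀≈y)) = #-injective (fib y) (ker? f) ker-resp (_- x₀)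
            (λ x (_ , fx≈y) → +-identityˡ-unique (f (x - x₀)) y (shift x fx≈y))
            (λ x x′ → +-cancelʳ (- x₀) x x′)
            where
            x₀ = enum i
            shift : ∀ x → f x ≈ y → f (x - x₀) + y ≈ y
            shift x fx≈y = trans (+-congˡ (sym fx₀≈y)) (trans (sym (f-+ _ _)) (trans
              (f-cong (trans (+-assoc _ _ _) (trans (+-congˡ (-‿inverseˡ x₀)) (+-identityʳ x))))
              fx≈y))

      -- Adding a preimage of `y` embeds the kernel into the fibre over `y`; the last hypothesis
      -- keeps the translate inside `S`.
      #-ker-≥ : S Respects _≈_ → (∀ y → T y → ∃ λ x → f x ≈ y) → (∀ x → T (f x) → S x) →
                # (ker? f) ℕ.* # T? ≤ # S?
      #-ker-≥ S-resp onto f⁻¹T⊆S = #-fibres-≥ S? T? T-resp f (# (ker? f)) bound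
        where
        bound : ∀ y → T y → # (ker? f) ≤ # (fibre? S? T? T-resp f y)
        bound y ty = #-injective (ker? f) (fibre? S? T? T-resp f y)
          (λ e (s , p) → S-resp e s , trans (f-cong (sym e)) p) (_+ x₀)
          (λ x fx≈0 → let e = shift x fx≈0 in f⁻¹T⊆S _ (T-resp (sym e) ty) , e)
          (λ x x′ → +-cancelʳ x₀ x x′)
          where
          x₀ = proj₁ (onto y ty)
          shift : ∀ x → f x ≈ 0# → f (x + x₀) ≈ y
          shift x fx≈0 = trans (f-+ x x₀)
            (trans (+-cong fx≈0 (proj₂ (onto y ty))) (+-identityˡ y))

-- Skew polynomials in σ over a field.

module Semilinear {r ℓ : Level} (R : CommutativeRing r ℓ)
                  (_≟_ : Decidable (CommutativeRing._≈_ R)) (isField : IsField R)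
                  (σ : CommutativeRing.Carrier R → CommutativeRing.Carrier R)
                  (aut : IsAutomorphism R σ) where
  open CommutativeRing R
  open IsField isField
  open IsAutomorphism aut
  open Algebra.Properties.Ring ring
    using (+-cancelˡ; +-cancelʳ; +-inverseʳ-unique; x+x≈x⇒x≈0; x∙y⁻¹≈ε⇒x≈y;
           -‿distribˡ-*)
  open Algebra.Solver.Ring.NaturalCoefficients.Default commutativeSemiring
    using (solve; _:=_; _:+_; _:*_)
  open Relation.Binary.Reasoning.Setoid setoid

  *-inverseˡ : ∀ x → ¬ x ≈ 0# → x ⁻¹ * x ≈ 1#
  *-inverseˡ x x≉0 = trans (*-comm _ _) (inverseʳ x x≉0)

  *-cancelʳ : ∀ x y z → ¬ z ≈ 0# → x * z ≈ y * z → x ≈ y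
  *-cancelʳ x y z z≉0 xz≈yz = begin
    x               ≈⟨ unit x ⟨
    x * z * z ⁻¹    ≈⟨ *-congʳ xz≈yz ⟩
    y * z * z ⁻¹    ≈⟨ unit y ⟩
    y               ∎
    where
    unit : ∀ t → t * z * z ⁻¹ ≈ t
    unit t = trans (*-assoc _ _ _) (trans (*-congˡ (inverseʳ z z≉0)) (*-identityʳ t))

  *-zeroˡ-reflecting : ∀ x z → ¬ z ≈ 0# → x * z ≈ 0# → x ≈ 0#
  *-zeroˡ-reflecting x z z≉0 xz≈0 = *-cancelʳ x 0# z z≉0 (trans xz≈0 (sym (zeroˡ z)))

  *-nonzero : ∀ x y → ¬ x ≈ 0# → ¬ y ≈ 0# → ¬ x * y ≈ 0#
  *-nonzero x y x≉0 y≉0 xy≈0 = x≉0 (*-zeroˡ-reflecting x y y≉0 xy≈0)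

  ⁻¹-nonzero : ∀ {u} → ¬ u ≈ 0# → ¬ u ⁻¹ ≈ 0#
  ⁻¹-nonzero {u} u≉0 u⁻¹≈0 =
    0≉1 (trans (sym (zeroʳ u)) (trans (*-congˡ (sym u⁻¹≈0)) (inverseʳ u u≉0)))

  σ-0 : σ 0# ≈ 0#
  σ-0 = x+x≈x⇒x≈0 (σ 0#) (trans (sym (σ-+ 0# 0#)) (σ-cong (+-identityˡ 0#)))

  σ-neg : ∀ x → σ (- x) ≈ - σ x
  σ-neg x = +-inverseʳ-unique (σ x) (σ (- x))
    (trans (sym (σ-+ x (- x))) (trans (σ-cong (-‿inverseʳ x)) σ-0))

  σ-nonzero : ∀ x → ¬ x ≈ 0# → ¬ σ x ≈ 0#
  σ-nonzero x x≉0 σx≈0 = x≉0 (σ-inj x 0# (trans σx≈0 (sym σ-0)))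

  iter-cong : ∀ k {x y} → x ≈ y → iter k σ x ≈ iter k σ y
  iter-cong zero    x≈y = x≈y
  iter-cong (suc k) x≈y = σ-cong (iter-cong k x≈y)

  iter-* : ∀ k x y → iter k σ (x * y) ≈ iter k σ x * iter k σ y
  iter-* zero    x y = refl
  iter-* (suc k) x y = trans (σ-cong (iter-* k x y)) (σ-* _ _)

  iter-neg : ∀ k x → iter k σ (- x) ≈ - iter k σ x
  iter-neg zero    x = refl
  iter-neg (suc k) x = trans (σ-cong (iter-neg k x)) (σ-neg _)

  iter-shift : ∀ k x → iter k σ (σ x) ≡ σ (iter k σ x)
  iter-shift zero    x = ≡.refl
  iter-shift (suc k) x = ≡.cong σ (iter-shift k x)

  infixr 5 _∷_

  -- Coefficients of p₀ + p₁σ + ⋯ + pₘσᵐ with pₘ ≠ 0, lowest first.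
  data SkewPoly : ℕ → Set (r ⊔ ℓ) where
    lead : ∀ c → ¬ c ≈ 0# → SkewPoly 0
    _∷_  : ∀ {m} → Carrier → SkewPoly m → SkewPoly (suc m)

  eval : ∀ {m} → SkewPoly m → Carrier → Carrier
  eval (lead c _) x = c * x
  eval (p ∷ P)    x = p * x + eval P (σ x)

  eval-cong : ∀ {m} (P : SkewPoly m) {x y} → x ≈ y → eval P x ≈ eval P y
  eval-cong (lead c _) x≈y = *-congˡ x≈y
  eval-cong (p ∷ P)    x≈y = +-cong (*-congˡ x≈y) (eval-cong P (σ-cong x≈y))

  eval-+ : ∀ {m} (P : SkewPoly m) x y → eval P (x + y) ≈ eval P x + eval P y
  eval-+ (lead c _) x y = distribˡ c x y
  eval-+ (p ∷ P)    x y = begin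
    p * (x + y) + eval P (σ (x + y))
      ≈⟨ +-congˡ (trans (eval-cong P (σ-+ x y)) (eval-+ P (σ x) (σ y))) ⟩
    p * (x + y) + (eval P (σ x) + eval P (σ y))
      ≈⟨ solve 5 (λ p x y u v → p :* (x :+ y) :+ (u :+ v) := (p :* x :+ u) :+ (p :* y :+ v))
           refl p x y (eval P (σ x)) (eval P (σ y)) ⟩
    eval (p ∷ P) x + eval (p ∷ P) y ∎

  eval-0 : ∀ {m} (P : SkewPoly m) → eval P 0# ≈ 0#
  eval-0 P = x+x≈x⇒x≈0 _ (trans (sym (eval-+ P 0# 0#)) (eval-cong P (+-identityˡ 0#)))

  -- The operator `σ - α`. The scalar `- α` stands as a factor so that the semiring solver can treat
  -- it as an atom.
  τ : Carrier → Carrier → Carrier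
  τ α x = σ x + (- α) * x

  τ-cong : ∀ α {x y} → x ≈ y → τ α x ≈ τ α y
  τ-cong α x≈y = +-cong (σ-cong x≈y) (*-congˡ x≈y)

  τ-+ : ∀ α x y → τ α (x + y) ≈ τ α x + τ α y
  τ-+ α x y = trans (+-congʳ (σ-+ x y))
    (solve 5 (λ a s t x y → (s :+ t) :+ a :* (x :+ y) := (s :+ a :* x) :+ (t :+ a :* y))
      refl (- α) (σ x) (σ y) x y)

  τ≈0⇒σ : ∀ α x → τ α x ≈ 0# → σ x ≈ α * x
  τ≈0⇒σ α x τx≈0 = x∙y⁻¹≈ε⇒x≈y (σ x) (α * x)
    (trans (+-congˡ (-‿distribˡ-* α x)) τx≈0)

  σ⇒τ≈0 : ∀ α x → σ x ≈ α * x → τ α x ≈ 0#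
  σ⇒τ≈0 α x e = trans (+-cong e (sym (-‿distribˡ-* α x))) (-‿inverseʳ (α * x))

  τ-root : ∀ {u} → ¬ u ≈ 0# → τ (σ u * u ⁻¹) u ≈ 0#
  τ-root {u} u≉0 = σ⇒τ≈0 _ u (sym
    (trans (*-assoc _ _ _) (trans (*-congˡ (*-inverseˡ u u≉0)) (*-identityʳ _))))

  -- Right division by `σ - α`. Because `σ (σ - α) = (σ - σ(α)) σ`, the tail of the polynomial is
  -- divided by `σ - σ(α)`. Its remainder contributes `r σ = r (σ - α) + r α`: the first summand
  -- supplies the constant term of the quotient, the second goes into the new remainder.
  divide : ∀ {m} (P : SkewPoly (suc m)) α →
           Σ (SkewPoly m) λ Q → ∃ λ r → ∀ x → eval P x ≈ eval Q (τ α x) + r * x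
  divide (p ∷ lead c c≉0) α = lead c c≉0 , p + c * α , λ x → sym (begin
    c * (σ x + (- α) * x) + (p + c * α) * x
      ≈⟨ solve 6 (λ p c α α⁻ s x → c :* (s :+ α⁻ :* x) :+ (p :+ c :* α) :* x
           := (p :* x :+ c :* s) :+ (α :+ α⁻) :* (c :* x)) refl p c α (- α) (σ x) x ⟩
    (p * x + c * σ x) + (α - α) * (c * x)
      ≈⟨ +-congˡ (trans (*-congʳ (-‿inverseʳ α)) (zeroˡ _)) ⟩
    (p * x + c * σ x) + 0#   ≈⟨ +-identityʳ _ ⟩
    p * x + c * σ x          ∎)
  divide (p ∷ P@(_ ∷ _)) α with divide P (σ α)
  ... | Q , r , P≈ = r ∷ Q , p + r * α , λ x → sym (begin
    (r * (σ x + (- α) * x) + eval Q (σ (τ α x))) + (p + r * α) * x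
      ≈⟨ solve 7 (λ p r α α⁻ s x q → (r :* (s :+ α⁻ :* x) :+ q) :+ (p :+ r :* α) :* x
           := (p :* x :+ (q :+ r :* s)) :+ (α :+ α⁻) :* (r :* x))
           refl p r α (- α) (σ x) x (eval Q (σ (τ α x))) ⟩
    (p * x + (eval Q (σ (τ α x)) + r * σ x)) + (α - α) * (r * x)
      ≈⟨ +-congˡ (trans (*-congʳ (-‿inverseʳ α)) (zeroˡ _)) ⟩
    (p * x + (eval Q (σ (τ α x)) + r * σ x)) + 0#   ≈⟨ +-identityʳ _ ⟩
    p * x + (eval Q (σ (τ α x)) + r * σ x)
      ≈⟨ +-congˡ (+-congʳ (eval-cong Q (σ-τ x))) ⟩
    p * x + (eval Q (τ (σ α) (σ x)) + r * σ x)      ≈⟨ +-congˡ (P≈ (σ x)) ⟨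
    p * x + eval P (σ x)                            ∎)
    where
    σ-τ : ∀ x → σ (τ α x) ≈ τ (σ α) (σ x)
    σ-τ x = trans (σ-+ _ _) (+-congˡ (trans (σ-* _ _) (*-congʳ (σ-neg α))))

  -- The product (σ + β) P, increased by the constant c.
  raise : ∀ {m} → Carrier → Carrier → SkewPoly m → SkewPoly (suc m)
  raise c β (lead p p≉0) = (c + β * p) ∷ lead (σ p) (σ-nonzero p p≉0)
  raise c β (p ∷ P)      = (c + β * p) ∷ raise (σ p) β P

  -- Since `σ p = σ(p) σ`, the image of each coefficient moves up one degree; the recursion hands it
  -- on as the constant `c` of the next stage.
  eval-raise : ∀ {m} c β (P : SkewPoly m) x →
               eval (raise c β P) x ≈ c * x + (β * eval P x + σ (eval P x))
  eval-raise c β (lead p _) x = begin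
    (c + β * p) * x + σ p * σ x     ≈⟨ +-congˡ (σ-* p x) ⟨
    (c + β * p) * x + σ (p * x)
      ≈⟨ solve 5 (λ c β p x s → (c :+ β :* p) :* x :+ s := c :* x :+ (β :* (p :* x) :+ s))
           refl c β p x (σ (p * x)) ⟩
    c * x + (β * (p * x) + σ (p * x))   ∎
  eval-raise c β (p ∷ P) x = begin
    (c + β * p) * x + eval (raise (σ p) β P) (σ x)
      ≈⟨ +-congˡ (eval-raise (σ p) β P (σ x)) ⟩
    (c + β * p) * x + (σ p * σ x + (β * eval P (σ x) + σ (eval P (σ x))))
      ≈⟨ solve 7 (λ c β p x s e t → (c :+ β :* p) :* x :+ (s :+ (β :* e :+ t))
           := c :* x :+ (β :* (p :* x :+ e) :+ (s :+ t)))
           refl c β p x (σ p * σ x) (eval P (σ x)) (σ (eval P (σ x))) ⟩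
    c * x + (β * eval (p ∷ P) x + (σ p * σ x + σ (eval P (σ x))))
      ≈⟨ +-congˡ (+-congˡ (trans (+-congʳ (sym (σ-* p x))) (sym (σ-+ _ _)))) ⟩
    c * x + (β * eval (p ∷ P) x + σ (eval (p ∷ P) x)) ∎

  -- The operator `P s - t P`: the coefficient of `σⁱ` is multiplied by `σⁱ(s) - t`. The hypothesis
  -- keeps the leading coefficient nonzero, so that the degree does not change.
  twist : ∀ {m} s t (P : SkewPoly m) → ¬ iter m σ s ≈ t → SkewPoly m
  twist s t (lead c c≉0) s≉t =
    lead (c * (s - t)) (*-nonzero c (s - t) c≉0 (s≉t ∘ x∙y⁻¹≈ε⇒x≈y s t))
  twist s t (_∷_ {m} p P) s≉t =
    p * (s - t) ∷ twist (σ s) t P (s≉t ∘ trans (reflexive (≡.sym (iter-shift m s))))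

  eval-twist : ∀ {m} s t (P : SkewPoly m) s≉t x →
               eval (twist s t P s≉t) x + t * eval P x ≈ eval P (s * x)
  eval-twist s t (lead c _) _ x = begin
    c * (s - t) * x + t * (c * x)
      ≈⟨ solve 5 (λ c s t t⁻ x → c :* (s :+ t⁻) :* x :+ t :* (c :* x)
           := c :* (s :* x) :+ (t :+ t⁻) :* (c :* x)) refl c s t (- t) x ⟩
    c * (s * x) + (t - t) * (c * x)
      ≈⟨ +-congˡ (trans (*-congʳ (-‿inverseʳ t)) (zeroˡ _)) ⟩
    c * (s * x) + 0#              ≈⟨ +-identityʳ _ ⟩
    c * (s * x)                   ∎
  eval-twist s t (p ∷ P) s≉t x = begin
    (p * (s - t) * x + e) + t * (p * x + eval P (σ x))
      ≈⟨ solve 7 (λ p s t t⁻ x e f → (p :* (s :+ t⁻) :* x :+ e) :+ t :* (p :* x :+ f)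
           := (p :* (s :* x) :+ (e :+ t :* f)) :+ (t :+ t⁻) :* (p :* x))
           refl p s t (- t) x e (eval P (σ x)) ⟩
    (p * (s * x) + (e + t * eval P (σ x))) + (t - t) * (p * x)
      ≈⟨ +-congˡ (trans (*-congʳ (-‿inverseʳ t)) (zeroˡ _)) ⟩
    (p * (s * x) + (e + t * eval P (σ x))) + 0#    ≈⟨ +-identityʳ _ ⟩
    p * (s * x) + (e + t * eval P (σ x))
      ≈⟨ +-congˡ (trans (eval-twist (σ s) t P _ (σ x)) (eval-cong P (sym (σ-* s x)))) ⟩
    p * (s * x) + eval P (σ (s * x))               ∎
    where e = eval (twist (σ s) t P _) (σ x)

  -- Dedekind's independence of the powers of σ: if P = p + P′σ vanishes, so does
  -- the operator P y - y P, which is P′ twisted by y, composed with σ.  Passing to the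
  -- twisted P′ lowers the degree, since σ is onto.
  not-identically-zero : ∀ {m} (P : SkewPoly m) →
    (∀ k → 0 < k → k ≤ m → ¬ (∀ x → iter k σ x ≈ x)) → ¬ (∀ x → eval P x ≈ 0#)
  not-identically-zero (lead c c≉0) _ P≈0 = c≉0 (trans (sym (*-identityʳ c)) (P≈0 1#))
  not-identically-zero {suc m} (p ∷ P) exact P≈0 =
    exact (suc m) (s≤s z≤n) ℕₚ.≤-refl fixed
    where
    lower : ∀ y x → eval P (σ y * σ x) ≈ y * eval P (σ x)
    lower y x = +-cancelˡ (p * (y * x)) _ _ (begin
      p * (y * x) + eval P (σ y * σ x)   ≈⟨ +-congˡ (eval-cong P (σ-* y x)) ⟨
      p * (y * x) + eval P (σ (y * x))   ≈⟨ P≈0 (y * x) ⟩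
      0#                                 ≈⟨ zeroʳ y ⟨
      y * 0#                             ≈⟨ *-congˡ (P≈0 x) ⟨
      y * (p * x + eval P (σ x))
        ≈⟨ solve 4 (λ p x y e → y :* (p :* x :+ e) := p :* (y :* x) :+ y :* e)
             refl p x y (eval P (σ x)) ⟩
      p * (y * x) + y * eval P (σ x)     ∎)

    fixed : ∀ y → iter (suc m) σ y ≈ y
    -- The leading coefficient of the twisted operator has the factor `σᵐ⁺¹(y) - y`. Were it
    -- nonzero, a skew polynomial of degree `m` would vanish identically, against the induction
    -- hypothesis. So `σᵐ⁺¹` fixes every `y`, which `exact` excludes.
    fixed y with iter m σ (σ y) ≟ y
    ... | yes e = trans (reflexive (≡.sym (iter-shift m y))) e
    ... | no σᵐ⁺¹y≉y = contradiction vanishes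
          (not-identically-zero (twist (σ y) y P σᵐ⁺¹y≉y)
            λ k 0<k k≤m → exact k 0<k (ℕₚ.m≤n⇒m≤1+n k≤m))
      where
      vanishes : ∀ x → eval (twist (σ y) y P σᵐ⁺¹y≉y) x ≈ 0#
      vanishes x with σ-surj x
      ... | x′ , σx′≈x = trans (eval-cong (twist (σ y) y P _) (sym σx′≈x))
        (+-cancelʳ (y * eval P (σ x′)) _ _
          (trans (eval-twist (σ y) y P _ (σ x′)) (trans (lower y x′) (sym (+-identityˡ _)))))

  -- Numbers of roots and the order of the fixed field.

  module RootCounting {N : ℕ} (card : HasCardinality R N) where
    open Counting R _≟_ card

    eval-additive : ∀ {m} (P : SkewPoly m) → IsAdditive (eval P)
    eval-additive P = record { f-cong = eval-cong P ; f-+ = eval-+ P }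

    τ-additive : ∀ α → IsAdditive (τ α)
    τ-additive α = record { f-cong = τ-cong α ; f-+ = τ-+ α }

    roots : ∀ {m} → SkewPoly m → ℕ
    roots P = # (ker? (eval P))

    fixed? : U.Decidable (λ x → σ x ≈ x)
    fixed? x = σ x ≟ x

    fixed-resp : (λ x → σ x ≈ x) Respects _≈_
    fixed-resp x≈y σx≈x = trans (σ-cong (sym x≈y)) (trans σx≈x x≈y)

    Q : ℕ
    Q = # fixed?

    1≤Q : 1 ≤ Q
    1≤Q = #-inhabited fixed? fixed-resp 1# σ-1

    -- For u ≠ 0 with σ u = α u, division and multiplication by u are inverse
    -- bijections between ker (σ - α) and the fixed field.
    ratio-fixed : ∀ α {u} → ¬ u ≈ 0# → τ α u ≈ 0# → ∀ x → τ α x ≈ 0# →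
                  σ (x * u ⁻¹) ≈ x * u ⁻¹
    ratio-fixed α {u} u≉0 τu≈0 x τx≈0 =
      *-cancelʳ _ _ (σ u) (σ-nonzero u u≉0) (begin
        σ (x * u ⁻¹) * σ u    ≈⟨ σ-* _ _ ⟨
        σ (x * u ⁻¹ * u)      ≈⟨ σ-cong ratio ⟩
        σ x                   ≈⟨ τ≈0⇒σ α x τx≈0 ⟩
        α * x                 ≈⟨ *-congˡ ratio ⟨
        α * (x * u ⁻¹ * u)
          ≈⟨ solve 3 (λ α y u → α :* (y :* u) := y :* (α :* u)) refl α (x * u ⁻¹) u ⟩
        x * u ⁻¹ * (α * u)    ≈⟨ *-congˡ (τ≈0⇒σ α u τu≈0) ⟨
        x * u ⁻¹ * σ u        ∎)
      where
      ratio : x * u ⁻¹ * u ≈ x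
      ratio = trans (*-assoc _ _ _) (trans (*-congˡ (*-inverseˡ u u≉0)) (*-identityʳ x))

    ker-τ-≤ : ∀ α {u} → ¬ u ≈ 0# → τ α u ≈ 0# → # (ker? (τ α)) ≤ Q
    ker-τ-≤ α {u} u≉0 τu≈0 = #-injective (ker? (τ α)) fixed? fixed-resp (_* u ⁻¹)
      (ratio-fixed α u≉0 τu≈0) (λ x y → *-cancelʳ x y (u ⁻¹) (⁻¹-nonzero u≉0))

    ker-τ-≥ : ∀ α {u} → ¬ u ≈ 0# → τ α u ≈ 0# → Q ≤ # (ker? (τ α))
    ker-τ-≥ α {u} u≉0 τu≈0 = #-injective fixed? (ker? (τ α)) (ker-resp (τ-additive α)) (_* u)
      (λ k σk≈k → σ⇒τ≈0 α (k * u) (begin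
        σ (k * u)      ≈⟨ σ-* k u ⟩
        σ k * σ u      ≈⟨ *-cong σk≈k (τ≈0⇒σ α u τu≈0) ⟩
        k * (α * u)    ≈⟨ solve 3 (λ k α u → k :* (α :* u) := α :* (k :* u)) refl k α u ⟩
        α * (k * u)    ∎))
      (λ x y → *-cancelʳ x y u u≉0)

    -- Induction on the degree. At a root `u ≠ 0`, `P = P′ (σ - α)`, and `σ - α` maps the roots of
    -- `P` to those of `P′` with fibres of at most `Q` elements. Without such `u` there is at most
    -- one root, and `1 ≤ Q` suffices.
    roots-≤ : ∀ {m} (P : SkewPoly m) → roots P ≤ Q ^ m
    roots-≤ (lead c c≉0) = #-unique (ker? (eval (lead c c≉0)))
      λ x y cx≈0 cy≈0 → trans (zero-only x cx≈0) (sym (zero-only y cy≈0))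
      where
      zero-only : ∀ x → c * x ≈ 0# → x ≈ 0#
      zero-only x cx≈0 = *-zeroˡ-reflecting x c c≉0 (trans (*-comm x c) cx≈0)
    roots-≤ {suc m} P@(_ ∷ _) = cases (∃? resp (λ x → ¬? (x ≟ 0#) ×-dec ker? (eval P) x))
      where
      resp : (λ x → ¬ x ≈ 0# × eval P x ≈ 0#) Respects _≈_
      resp x≈y (x≉0 , Px≈0) =
        (λ y≈0 → x≉0 (trans x≈y y≈0)) , ker-resp (eval-additive P) x≈y Px≈0

      cases : Dec (∃ λ x → ¬ x ≈ 0# × eval P x ≈ 0#) → roots P ≤ Q ^ suc m
      cases (no ¬∃) = ℕₚ.≤-trans
        (#-unique (ker? (eval P)) λ x y p q → trans (zero-only x p) (sym (zero-only y q)))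
        (≡.subst (_≤ Q ^ suc m) (ℕₚ.^-zeroˡ (suc m)) (ℕₚ.^-monoˡ-≤ (suc m) 1≤Q))
        where
        zero-only : ∀ x → eval P x ≈ 0# → x ≈ 0#
        zero-only x Px≈0 with x ≟ 0#
        ... | yes x≈0 = x≈0
        ... | no x≉0 = contradiction (x , x≉0 , Px≈0) ¬∃
      cases (yes (u , u≉0 , Pu≈0)) = ℕₚ.≤-trans
        (#-ker-≤ (τ-additive α) (ker? (eval P)) (ker? (eval P′))
          (ker-resp (eval-additive P′)) factors)
        (ℕₚ.*-mono-≤ (ker-τ-≤ α u≉0 (τ-root u≉0)) (roots-≤ P′))
        where
        α = σ u * u ⁻¹
        P′ = proj₁ (divide P α)
        ρ = proj₁ (proj₂ (divide P α))
        P≈ = proj₂ (proj₂ (divide P α))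

        ρ≈0 : ρ ≈ 0#
        -- At `u` the factor `σ - α` vanishes, so only the remainder is left of `P u = 0`.
        ρ≈0 = *-zeroˡ-reflecting ρ u u≉0 (begin
          ρ * u                         ≈⟨ +-identityˡ _ ⟨
          0# + ρ * u                    ≈⟨ +-congʳ (trans (eval-cong P′ (τ-root u≉0)) (eval-0 P′)) ⟨
          eval P′ (τ α u) + ρ * u       ≈⟨ P≈ u ⟨
          eval P u                      ≈⟨ Pu≈0 ⟩
          0#                            ∎)

        factors : ∀ x → eval P x ≈ 0# → eval P′ (τ α x) ≈ 0#
        factors x Px≈0 = begin
          eval P′ (τ α x)           ≈⟨ +-identityʳ _ ⟨
          eval P′ (τ α x) + 0#      ≈⟨ +-congˡ (trans (*-congʳ ρ≈0) (zeroˡ x)) ⟨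
          eval P′ (τ α x) + ρ * x   ≈⟨ P≈ x ⟨
          eval P x                  ≈⟨ Px≈0 ⟩
          0#                        ∎

    -- Operators are linear over the fixed field of `σ`; hence the image of `P` contains every fixed
    -- multiple of each of its values.
    eval-fixed : ∀ {m} (P : SkewPoly m) k → σ k ≈ k → ∀ x → eval P (k * x) ≈ k * eval P x
    eval-fixed (lead c _) k _ x =
      solve 3 (λ c k x → c :* (k :* x) := k :* (c :* x)) refl c k x
    eval-fixed (p ∷ P) k σk≈k x = begin
      p * (k * x) + eval P (σ (k * x))
        ≈⟨ +-congˡ (eval-cong P (trans (σ-* k x) (*-congʳ σk≈k))) ⟩
      p * (k * x) + eval P (k * σ x)     ≈⟨ +-congˡ (eval-fixed P k σk≈k (σ x)) ⟩
      p * (k * x) + k * eval P (σ x)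
        ≈⟨ solve 4 (λ p k x e → p :* (k :* x) :+ k :* e := k :* (p :* x :+ e))
             refl p k x (eval P (σ x)) ⟩
      k * (p * x + eval P (σ x))         ∎

    -- As long as P does not vanish at some e, left multiplication by
    -- σ - σ(P e)/(P e) enlarges the kernel by the factor Q.
    many-roots : ∀ m → (∀ k → 0 < k → k < m → ¬ (∀ x → iter k σ x ≈ x)) →
                 Σ (SkewPoly m) λ P → Q ^ m ≤ roots P
    many-roots zero exact = P , #-inhabited (ker? (eval P)) (ker-resp (eval-additive P)) 0# (eval-0 P)
      where
      P = lead 1# (0≉1 ∘ sym)
    many-roots (suc m) exact
      with many-roots m (λ k 0<k k<m → exact k 0<k (ℕₚ.m<n⇒m<1+n k<m))
    ... | P , Qᵐ≤ = extend (∃? resp (λ x → ¬? (eval P x ≟ 0#)))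
      where
      resp : (λ x → ¬ eval P x ≈ 0#) Respects _≈_
      resp x≈y Px≉0 Py≈0 = Px≉0 (trans (eval-cong P x≈y) Py≈0)

      extend : Dec (∃ λ x → ¬ eval P x ≈ 0#) → Σ (SkewPoly (suc m)) λ P′ → Q ^ suc m ≤ roots P′
      extend (no ¬∃) = contradiction all-zero
        (not-identically-zero P λ k 0<k k≤m → exact k 0<k (s≤s k≤m))
        where
        all-zero : ∀ x → eval P x ≈ 0#
        all-zero x with eval P x ≟ 0#
        ... | yes Px≈0 = Px≈0
        ... | no Px≉0 = contradiction (x , Px≉0) ¬∃
      -- `P′ = (σ - α) P`, so the roots of `P′` form the preimage under `P` of the kernel of
      -- `σ - α`. That kernel lies in the image of `P` and has at least `Q` elements.
      extend (yes (e , v≉0)) = P′ , ℕₚ.≤-trans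
        (ℕₚ.≤-trans (ℕₚ.≤-reflexive (ℕₚ.*-comm Q (Q ^ m)))
          (ℕₚ.*-mono-≤ Qᵐ≤ (ker-τ-≥ α v≉0 (τ-root v≉0))))
        (#-ker-≥ (eval-additive P) (ker? (eval P′)) (ker? (τ α)) (ker-resp (τ-additive α))
          (ker-resp (eval-additive P′)) onto (λ x → trans (factors x)))
        where
        v = eval P e
        α = σ v * v ⁻¹
        P′ = raise 0# (- α) P

        factors : ∀ x → eval P′ x ≈ τ α (eval P x)
        factors x = begin
          eval P′ x                                            ≈⟨ eval-raise 0# (- α) P x ⟩
          0# * x + ((- α) * eval P x + σ (eval P x))           ≈⟨ +-congʳ (zeroˡ x) ⟩
          0# + ((- α) * eval P x + σ (eval P x))               ≈⟨ +-identityˡ _ ⟩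
          (- α) * eval P x + σ (eval P x)                      ≈⟨ +-comm _ _ ⟩
          τ α (eval P x)                                       ∎

        onto : ∀ y → τ α y ≈ 0# → ∃ λ x → eval P x ≈ y
        -- As `σ - α` kills both `y` and `v`, the ratio `y / v` is fixed by `σ` and can be pulled
        -- out of `P ((y / v) e)`, leaving `(y / v) v`.
        onto y τy≈0 = y * v ⁻¹ * e , (begin
          eval P (y * v ⁻¹ * e)
            ≈⟨ eval-fixed P _ (ratio-fixed α v≉0 (τ-root v≉0) y τy≈0) e ⟩
          y * v ⁻¹ * v             ≈⟨ *-assoc _ _ _ ⟩
          y * (v ⁻¹ * v)           ≈⟨ *-congˡ (*-inverseˡ v v≉0) ⟩
          y * 1#                   ≈⟨ *-identityʳ y ⟩
          y                        ∎)

    Qⁿ≤N : ∀ n → (∀ k → 0 < k → k < n → ¬ (∀ x → iter k σ x ≈ x)) → Q ^ n ≤ N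
    Qⁿ≤N n exact with many-roots n exact
    ... | P , Qⁿ≤ = ℕₚ.≤-trans Qⁿ≤ (#-≤ (ker? (eval P)))

-- Powers of σ modulo right division by L.

module Reduction {r ℓ : Level} (R : CommutativeRing r ℓ)
                 (_≟_ : Decidable (CommutativeRing._≈_ R)) (isField : IsField R)
                 (σ : CommutativeRing.Carrier R → CommutativeRing.Carrier R)
                 (aut : IsAutomorphism R σ)
                 (a b c d : CommutativeRing.Carrier R)
                 (abcd≉0 : ¬ (CommutativeRing._≈_ R
                   (CommutativeRing._*_ R (CommutativeRing._*_ R (CommutativeRing._*_ R a b) c) d)
                   (CommutativeRing.0# R))) where
  open CommutativeRing R
  open IsField isField
  open IsAutomorphism aut
  open Semilinear R _≟_ isField σ aut
  open Quadrinomial R _⁻¹ σ a b c d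
  open Algebra.Properties.Ring ring using (-1*x≈-x; -‿distribˡ-*; -‿distribʳ-*; -‿involutive)
  open Algebra.Solver.Ring.NaturalCoefficients.Default commutativeSemiring
    using (solve; _:=_; _:+_; _:*_)
  open Relation.Binary.Reasoning.Setoid setoid

  d≉0 : ¬ d ≈ 0#
  d≉0 d≈0 = abcd≉0 (trans (*-congˡ d≈0) (zeroʳ _))

  c≉0 : ¬ c ≈ 0#
  c≉0 c≈0 = abcd≉0 (trans (*-congʳ (trans (*-congˡ c≈0) (zeroʳ _))) (zeroˡ _))

  b≉0 : ¬ b ≈ 0#
  b≉0 b≈0 = abcd≉0 (trans (*-congʳ (trans (*-congʳ
    (trans (*-congˡ b≈0) (zeroʳ _))) (zeroˡ _))) (zeroˡ _))

  -- Chosen so that `σ³ = α + β σ + γ σ²` on the roots of `L`.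
  u α β γ : Carrier
  u = c / d
  α = - (a / d)
  β = - (b / d)
  γ = - u

  -- The offset `s` says how far the coefficients are twisted at the start. Dropping the first term
  -- of a solution raises `s` by one, and so does applying `σ` to all terms; this makes the two
  -- operations comparable.
  Recurrent : ℕ → (ℕ → Carrier) → Set ℓ
  Recurrent s X = ∀ k → X (3 ℕ.+ k) ≈
    iter (s ℕ.+ k) σ α * X k + iter (s ℕ.+ k) σ β * X (1 ℕ.+ k)
      + iter (s ℕ.+ k) σ γ * X (2 ℕ.+ k)

  recurrent-unique : ∀ s {X Y} → Recurrent s X → Recurrent s Y →
                     X 0 ≈ Y 0 → X 1 ≈ Y 1 → X 2 ≈ Y 2 → ∀ k → X k ≈ Y k
  recurrent-unique s {X} {Y} rX rY e₀ e₁ e₂ k = proj₁ (three k)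
    where
    three : ∀ k → X k ≈ Y k × X (1 ℕ.+ k) ≈ Y (1 ℕ.+ k) × X (2 ℕ.+ k) ≈ Y (2 ℕ.+ k)
    three zero    = e₀ , e₁ , e₂
    three (suc k) with three k
    ... | p₀ , p₁ , p₂ = p₁ , p₂ , trans (rX k)
      (trans (+-cong (+-cong (*-congˡ p₀) (*-congˡ p₁)) (*-congˡ p₂)) (sym (rY k)))

  recurrent-+ : ∀ s {X Y} → Recurrent s X → Recurrent s Y → Recurrent s (λ k → X k + Y k)
  recurrent-+ s rX rY k = trans (+-cong (rX k) (rY k))
    (solve 9 (λ a b c x₀ x₁ x₂ y₀ y₁ y₂ →
        (a :* x₀ :+ b :* x₁ :+ c :* x₂) :+ (a :* y₀ :+ b :* y₁ :+ c :* y₂)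
          := a :* (x₀ :+ y₀) :+ b :* (x₁ :+ y₁) :+ c :* (x₂ :+ y₂))
      refl _ _ _ _ _ _ _ _ _)

  recurrent-* : ∀ s {X} e → Recurrent s X → Recurrent s (λ k → e * X k)
  recurrent-* s e rX k = trans (*-congˡ (rX k))
    (solve 7 (λ e a b c x₀ x₁ x₂ → e :* (a :* x₀ :+ b :* x₁ :+ c :* x₂)
          := a :* (e :* x₀) :+ b :* (e :* x₁) :+ c :* (e :* x₂))
      refl _ _ _ _ _ _ _)

  recurrent-σ : ∀ s {X} → Recurrent s X → Recurrent (suc s) (σ ∘ X)
  recurrent-σ s rX k = trans (σ-cong (rX k))
    (trans (σ-+ _ _) (+-cong (trans (σ-+ _ _) (+-cong (σ-* _ _) (σ-* _ _))) (σ-* _ _)))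

  -- The recurrence comes from multiplying `σ³ = α + β σ + γ σ²` by `σᵏ` on the left, which twists
  -- the coefficients by `σᵏ`.
  sequence : Carrier → Carrier → Carrier → ℕ → Carrier
  sequence x y z 0 = x
  sequence x y z 1 = y
  sequence x y z 2 = z
  sequence x y z (suc (suc (suc k))) =
    iter k σ α * sequence x y z k + iter k σ β * sequence x y z (suc k)
      + iter k σ γ * sequence x y z (suc (suc k))

  sequence-recurrent : ∀ x y z → Recurrent 0 (sequence x y z)
  sequence-recurrent x y z k = refl

  -- On the roots of L, σᵏ acts as A k + B k σ + C k σ².
  A B C : ℕ → Carrier
  A = sequence 1# 0# 0#
  B = sequence 0# 1# 0#
  C = sequence 0# 0# 1#

  A₃ : A 3 ≈ α
  A₃ = trans (+-cong (+-cong (*-identityʳ α) (zeroʳ β)) (zeroʳ γ))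
         (trans (+-identityʳ _) (+-identityʳ _))

  B₃ : B 3 ≈ β
  B₃ = trans (+-cong (+-cong (zeroʳ α) (*-identityʳ β)) (zeroʳ γ))
         (trans (+-identityʳ _) (+-identityˡ _))

  C₃ : C 3 ≈ γ
  C₃ = trans (+-cong (+-cong (zeroʳ α) (zeroʳ β)) (*-identityʳ γ))
         (trans (+-congʳ (+-identityˡ 0#)) (+-identityˡ _))

  x*σ0≈0 : ∀ x → x * σ 0# ≈ 0#
  x*σ0≈0 x = trans (*-congˡ σ-0) (zeroʳ x)

  x*σ1≈x : ∀ x → x * σ 1# ≈ x
  x*σ1≈x x = trans (*-congˡ σ-1) (*-identityʳ x)

  σ0+x*σ0≈0 : ∀ x → σ 0# + x * σ 0# ≈ 0#
  σ0+x*σ0≈0 x = trans (+-cong σ-0 (x*σ0≈0 x)) (+-identityˡ 0#)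

  σ1+x*σ0≈1 : ∀ x → σ 1# + x * σ 0# ≈ 1#
  σ1+x*σ0≈1 x = trans (+-cong σ-1 (x*σ0≈0 x)) (+-identityʳ 1#)

  σ0+x*σ1≈x : ∀ x → σ 0# + x * σ 1# ≈ x
  σ0+x*σ1≈x x = trans (+-cong σ-0 (x*σ1≈x x)) (+-identityˡ x)

  -- This and the next two lemmas express `σᵏ⁺¹ = σ σᵏ`: applying `σ` to `A k + B k σ + C k σ²`
  -- creates the term `σ(C k) σ³`, which is reduced again. Both sides solve the recurrence with
  -- offset 1, so three initial values decide.
  A-suc : ∀ k → A (suc k) ≈ α * σ (C k)
  A-suc = recurrent-unique 1 (λ k → refl)
    (recurrent-* 1 α (recurrent-σ 0 (sequence-recurrent 0# 0# 1#)))
    (sym (x*σ0≈0 α)) (sym (x*σ0≈0 α)) (trans A₃ (sym (x*σ1≈x α)))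

  B-suc : ∀ k → B (suc k) ≈ σ (A k) + β * σ (C k)
  B-suc = recurrent-unique 1 (λ k → refl)
    (recurrent-+ 1 (recurrent-σ 0 (sequence-recurrent 1# 0# 0#))
      (recurrent-* 1 β (recurrent-σ 0 (sequence-recurrent 0# 0# 1#))))
    (sym (σ1+x*σ0≈1 β)) (sym (σ0+x*σ0≈0 β)) (trans B₃ (sym (σ0+x*σ1≈x β)))

  C-suc : ∀ k → C (suc k) ≈ σ (B k) + γ * σ (C k)
  C-suc = recurrent-unique 1 (λ k → refl)
    (recurrent-+ 1 (recurrent-σ 0 (sequence-recurrent 0# 1# 0#))
      (recurrent-* 1 γ (recurrent-σ 0 (sequence-recurrent 0# 0# 1#))))
    (sym (σ0+x*σ0≈0 γ)) (sym (σ1+x*σ0≈1 γ)) (trans C₃ (sym (σ0+x*σ1≈x γ)))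

  σ³-reduce : ∀ x → iter 3 σ x ≈ d ⁻¹ * L x + (α * x + β * iter 1 σ x + γ * iter 2 σ x)
  σ³-reduce x = sym (begin
    d ⁻¹ * L x + (α * x + β * iter 1 σ x + γ * iter 2 σ x)
      ≈⟨ solve 12 (λ a b c d d⁻ x₀ x₁ x₂ x₃ α β γ →
           d⁻ :* (a :* x₀ :+ b :* x₁ :+ c :* x₂ :+ d :* x₃) :+ (α :* x₀ :+ β :* x₁ :+ γ :* x₂)
           := d :* d⁻ :* x₃ :+ ((a :* d⁻ :+ α) :* x₀ :+ (b :* d⁻ :+ β) :* x₁
                :+ (c :* d⁻ :+ γ) :* x₂))
           refl a b c d (d ⁻¹) x (iter 1 σ x) (iter 2 σ x) (iter 3 σ x) α β γ ⟩
    d * d ⁻¹ * iter 3 σ x + ((a / d + α) * x + (b / d + β) * iter 1 σ x + (c / d + γ) * iter 2 σ x)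
      ≈⟨ +-cong (trans (*-congʳ (inverseʳ d d≉0)) (*-identityˡ _))
           (+-cong (+-cong (vanish _ _) (vanish _ _)) (vanish _ _)) ⟩
    iter 3 σ x + (0# + 0# + 0#)
      ≈⟨ trans (+-congˡ (trans (+-identityʳ _) (+-identityʳ _))) (+-identityʳ _) ⟩
    iter 3 σ x   ∎)
    where
    vanish : ∀ e t → (e - e) * t ≈ 0#
    vanish e t = trans (*-congʳ (-‿inverseʳ e)) (zeroˡ t)

  -- The division of `σ³⁺ᵏ` is multiplied by `σ` on the left; reducing the new term in `σ³` adds
  -- only a constant to the quotient. The type fixes the degree of the quotient as `k`, which bounds
  -- the number of its roots.
  σ-power-reduce : ∀ k → Σ (SkewPoly k) λ P → ∀ x → iter (3 ℕ.+ k) σ x ≈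
    eval P (L x) + (A (3 ℕ.+ k) * x + B (3 ℕ.+ k) * iter 1 σ x + C (3 ℕ.+ k) * iter 2 σ x)
  σ-power-reduce zero = lead (d ⁻¹) (⁻¹-nonzero d≉0) , λ x → trans (σ³-reduce x)
    (+-congˡ (sym (+-cong (+-cong (*-congʳ A₃) (*-congʳ B₃)) (*-congʳ C₃))))
  σ-power-reduce (suc k) with σ-power-reduce k
  ... | P , reduce = raise (σ Cₖ * d ⁻¹) 0# P , λ x → begin
    σ (iter (3 ℕ.+ k) σ x)      ≈⟨ σ-cong (reduce x) ⟩
    σ (eval P (L x) + (Aₖ * x + Bₖ * iter 1 σ x + Cₖ * iter 2 σ x))
      ≈⟨ trans (σ-+ _ _) (+-congˡ (trans (σ-+ _ _)
           (+-cong (trans (σ-+ _ _) (+-cong (σ-* _ _) (σ-* _ _))) (σ-* _ _)))) ⟩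
    σ (eval P (L x)) + (σ Aₖ * iter 1 σ x + σ Bₖ * iter 2 σ x + σ Cₖ * iter 3 σ x)
      ≈⟨ +-congˡ (+-congˡ (*-congˡ (σ³-reduce x))) ⟩
    σ (eval P (L x)) + (σ Aₖ * iter 1 σ x + σ Bₖ * iter 2 σ x
      + σ Cₖ * (d ⁻¹ * L x + (α * x + β * iter 1 σ x + γ * iter 2 σ x)))
      ≈⟨ solve 12 (λ p A B C x₀ x₁ x₂ d⁻ l α β γ →
           p :+ (A :* x₁ :+ B :* x₂ :+ C :* (d⁻ :* l :+ (α :* x₀ :+ β :* x₁ :+ γ :* x₂)))
           := (C :* d⁻ :* l :+ p) :+
              (α :* C :* x₀ :+ (A :+ β :* C) :* x₁ :+ (B :+ γ :* C) :* x₂))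
           refl (σ (eval P (L x))) (σ Aₖ) (σ Bₖ) (σ Cₖ) x (iter 1 σ x) (iter 2 σ x)
           (d ⁻¹) (L x) α β γ ⟩
    (σ Cₖ * d ⁻¹ * L x + σ (eval P (L x))) + (α * σ Cₖ * x
      + (σ Aₖ + β * σ Cₖ) * iter 1 σ x + (σ Bₖ + γ * σ Cₖ) * iter 2 σ x)
      ≈⟨ +-cong (sym (raised x)) (sym (+-cong (+-cong (*-congʳ (A-suc (3 ℕ.+ k)))
           (*-congʳ (B-suc (3 ℕ.+ k)))) (*-congʳ (C-suc (3 ℕ.+ k))))) ⟩
    eval (raise (σ Cₖ * d ⁻¹) 0# P) (L x)
      + (A (4 ℕ.+ k) * x + B (4 ℕ.+ k) * iter 1 σ x + C (4 ℕ.+ k) * iter 2 σ x) ∎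
    where
    Aₖ Bₖ Cₖ : Carrier
    Aₖ = A (3 ℕ.+ k)
    Bₖ = B (3 ℕ.+ k)
    Cₖ = C (3 ℕ.+ k)

    raised : ∀ x → eval (raise (σ Cₖ * d ⁻¹) 0# P) (L x)
                   ≈ σ Cₖ * d ⁻¹ * L x + σ (eval P (L x))
    raised x = trans (eval-raise _ 0# P (L x))
      (+-congˡ (trans (+-congʳ (zeroˡ _)) (+-identityˡ _)))

  -- The sequence H as a sequence of remainder coefficients.

  z-σu-u : z * σ u * u ≈ σ (b / d)
  z-σu-u = begin
    σ b * d * i * σ (c * d ⁻¹) * (c * d ⁻¹)     ≈⟨ *-congʳ (*-congˡ (σ-* c (d ⁻¹))) ⟩
    σ b * d * i * (σ c * δ) * (c * d ⁻¹)
      ≈⟨ solve 7 (λ sb d i sc δ c d⁻ → sb :* d :* i :* (sc :* δ) :* (c :* d⁻)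
           := (sc :* c :* i) :* ((d :* d⁻) :* (sb :* δ))) refl (σ b) d i (σ c) δ c (d ⁻¹) ⟩
    σ c * c * i * (d * d ⁻¹ * (σ b * δ))
      ≈⟨ *-cong (inverseʳ _ (*-nonzero _ _ (σ-nonzero c c≉0) c≉0))
           (trans (*-congʳ (inverseʳ d d≉0)) (*-identityˡ _)) ⟩
    1# * (σ b * δ)         ≈⟨ *-identityˡ _ ⟩
    σ b * δ                ≈⟨ σ-* b (d ⁻¹) ⟨
    σ (b / d)              ∎
    where
    i = (σ c * c) ⁻¹
    δ = σ (d ⁻¹)

  -- As in `z-σu-u`, the denominators of `w` and `z` cancel. The two identities translate between
  -- the coefficients `w`, `z` of the recurrence for `H` and the coefficients `a / d`, `b / d` of
  -- the one for `C`.
  w-z-σu : w * z * σ u * (b / d) ≈ σ (a / d)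
  w-z-σu = begin
    σ a * c * j * (σ b * d * i) * σ (c * d ⁻¹) * (b * d ⁻¹)
      ≈⟨ *-congʳ (*-congˡ (σ-* c (d ⁻¹))) ⟩
    σ a * c * j * (σ b * d * i) * (σ c * δ) * (b * d ⁻¹)
      ≈⟨ solve 10 (λ sa c j sb d i sc δ b d⁻ →
           sa :* c :* j :* (sb :* d :* i) :* (sc :* δ) :* (b :* d⁻)
           := (sb :* b :* j) :* ((sc :* c :* i) :* ((d :* d⁻) :* (sa :* δ))))
           refl (σ a) c j (σ b) d i (σ c) δ b (d ⁻¹) ⟩
    σ b * b * j * (σ c * c * i * (d * d ⁻¹ * (σ a * δ)))
      ≈⟨ *-cong (inverseʳ _ (*-nonzero _ _ (σ-nonzero b b≉0) b≉0))
           (*-cong (inverseʳ _ (*-nonzero _ _ (σ-nonzero c c≉0) c≉0))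
             (trans (*-congʳ (inverseʳ d d≉0)) (*-identityˡ _))) ⟩
    1# * (1# * (σ a * δ))    ≈⟨ trans (*-identityˡ _) (*-identityˡ _) ⟩
    σ a * δ                  ≈⟨ σ-* a (d ⁻¹) ⟨
    σ (a / d)                ∎
    where
    i = (σ c * c) ⁻¹
    j = (σ b * b) ⁻¹
    δ = σ (d ⁻¹)

  shift : ∀ k x → iter k σ (σ x) ≈ iter (suc k) σ x
  shift k x = reflexive (iter-shift k x)

  iter-b : ∀ k → iter (suc k) σ (b / d) ≈ iter k σ z * iter (suc k) σ u * iter k σ u
  iter-b k = begin
    iter (suc k) σ (b / d)      ≈⟨ shift k (b / d) ⟨
    iter k σ (σ (b / d))        ≈⟨ iter-cong k z-σu-u ⟨
    iter k σ (z * σ u * u)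
      ≈⟨ trans (iter-* k _ _) (*-congʳ (trans (iter-* k _ _) (*-congˡ (shift k u)))) ⟩
    iter k σ z * iter (suc k) σ u * iter k σ u ∎

  -- Expanding the conjugate of `b / d` from `w-z-σu` by `iter-b` produces the product of two
  -- consecutive conjugates of `z` that occurs in `H`.
  iter-a : ∀ k → iter (2 ℕ.+ k) σ (a / d) ≈ iter (suc k) σ w * iter (suc k) σ z
    * iter (2 ℕ.+ k) σ u * (iter k σ z * iter (suc k) σ u * iter k σ u)
  iter-a k = begin
    iter (2 ℕ.+ k) σ (a / d)                  ≈⟨ shift (suc k) (a / d) ⟨
    iter (suc k) σ (σ (a / d))                ≈⟨ iter-cong (suc k) w-z-σu ⟨
    iter (suc k) σ (w * z * σ u * (b / d))
      ≈⟨ trans (iter-* (suc k) _ _) (*-cong (trans (iter-* (suc k) _ _)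
           (*-cong (iter-* (suc k) w z) (shift (suc k) u))) (iter-b k)) ⟩
    iter (suc k) σ w * iter (suc k) σ z * iter (2 ℕ.+ k) σ u
      * (iter k σ z * iter (suc k) σ u * iter k σ u) ∎

  M : ℕ → Carrier
  M k = Norm k u

  -- The factors `u₀`, `u₁`, `u₂` of `M (3 + k)` are shared out: in each term, those that do not
  -- complete the partial norm beside `H` turn its coefficient into a conjugate of `α`, `β` or `γ`.
  M*H-recurrent : Recurrent 2 (λ k → M k * H k)
  M*H-recurrent k = begin
    Mₖ * u₀ * u₁ * u₂ * ((- h₂) + (- (z₁ * h₁)) + (- (w₁ * (z₁ * z₀) * h₀)))
      -- Signs become the factor `ν`, an atom for the solver with natural coefficients.
      ≈⟨ *-congˡ (+-cong (+-cong (neg _) (neg _)) (neg _)) ⟩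
    Mₖ * u₀ * u₁ * u₂ * (ν * h₂ + ν * (z₁ * h₁) + ν * (w₁ * (z₁ * z₀) * h₀))
      ≈⟨ solve 11 (λ ν m u₀ u₁ u₂ z₀ z₁ w₁ h₀ h₁ h₂ →
           m :* u₀ :* u₁ :* u₂ :* (ν :* h₂ :+ ν :* (z₁ :* h₁) :+ ν :* (w₁ :* (z₁ :* z₀) :* h₀))
           := ν :* (w₁ :* z₁ :* u₂ :* (z₀ :* u₁ :* u₀)) :* (m :* h₀)
              :+ ν :* (z₁ :* u₂ :* u₁) :* (m :* u₀ :* h₁)
              :+ ν :* u₂ :* (m :* u₀ :* u₁ :* h₂))
           refl ν Mₖ u₀ u₁ u₂ z₀ z₁ w₁ h₀ h₁ h₂ ⟩
    ν * (w₁ * z₁ * u₂ * (z₀ * u₁ * u₀)) * (Mₖ * h₀) + ν * (z₁ * u₂ * u₁) * (Mₖ * u₀ * h₁)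
      + ν * u₂ * (Mₖ * u₀ * u₁ * h₂)
      ≈⟨ +-cong (+-cong (*-congʳ (*-congˡ (iter-a k))) (*-congʳ (*-congˡ (iter-b (suc k))))) refl ⟨
    ν * iter (2 ℕ.+ k) σ (a / d) * (Mₖ * h₀) + ν * iter (2 ℕ.+ k) σ (b / d) * (Mₖ * u₀ * h₁)
      + ν * u₂ * (Mₖ * u₀ * u₁ * h₂)
      ≈⟨ +-cong (+-cong (*-congʳ (iter-ν (a / d))) (*-congʳ (iter-ν (b / d))))
           (*-congʳ (iter-ν u)) ⟨
    iter (2 ℕ.+ k) σ α * (Mₖ * h₀) + iter (2 ℕ.+ k) σ β * (Mₖ * u₀ * h₁)
      + iter (2 ℕ.+ k) σ γ * (Mₖ * u₀ * u₁ * h₂) ∎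
    where
    ν Mₖ u₀ u₁ u₂ z₀ z₁ w₁ h₀ h₁ h₂ : Carrier
    ν = - 1#
    Mₖ = M k
    u₀ = iter k σ u
    u₁ = iter (1 ℕ.+ k) σ u
    u₂ = iter (2 ℕ.+ k) σ u
    z₀ = iter k σ z
    z₁ = iter (1 ℕ.+ k) σ z
    w₁ = iter (1 ℕ.+ k) σ w
    h₀ = H k
    h₁ = H (1 ℕ.+ k)
    h₂ = H (2 ℕ.+ k)

    neg : ∀ x → - x ≈ ν * x
    neg x = sym (-1*x≈-x x)

    iter-ν : ∀ x → iter (2 ℕ.+ k) σ (- x) ≈ ν * iter (2 ℕ.+ k) σ x
    iter-ν x = trans (iter-neg (2 ℕ.+ k) x) (neg _)

  -- `C` starts with 0, 0, 1, so its index is ahead by 2. Both sides solve the recurrence with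
  -- offset 2 and start with `1`, `- u`, `u σ(u) - σ(b / d)`.
  C≈M*H : ∀ k → C (2 ℕ.+ k) ≈ M k * H k
  C≈M*H = recurrent-unique 2 (λ k → refl) M*H-recurrent
    (sym (*-identityˡ 1#)) (trans C₃ H₁) (trans C₄ (sym H₂))
    where
    H₁ : γ ≈ 1# * u * - 1#
    H₁ = sym (trans (*-comm _ _) (trans (-1*x≈-x _) (-‿cong (*-identityˡ u))))

    C₄ : C 4 ≈ σ u * u + (- σ (b / d))
    C₄ = begin
      σ α * 0# + σ β * 1# + σ γ * C 3
        ≈⟨ +-cong (trans (+-cong (zeroʳ _) (*-identityʳ _)) (+-identityˡ _)) (*-congˡ C₃) ⟩
      σ β + σ γ * γ              ≈⟨ +-cong (σ-neg _) (*-congʳ (σ-neg u)) ⟩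
      (- σ (b / d)) + (- σ u) * (- u)
        ≈⟨ +-congˡ (trans (sym (-‿distribˡ-* _ _)) (trans (-‿cong (sym (-‿distribʳ-* _ _)))
             (-‿involutive _))) ⟩
      (- σ (b / d)) + σ u * u    ≈⟨ +-comm _ _ ⟩
      σ u * u + (- σ (b / d))    ∎

    H₂ : 1# * u * σ u * (1# + (- z)) ≈ σ u * u + (- σ (b / d))
    H₂ = begin
      1# * u * σ u * (1# + (- z))    ≈⟨ *-congʳ (trans (*-congʳ (*-identityˡ u)) (*-comm _ _)) ⟩
      σ u * u * (1# + (- z))         ≈⟨ distribˡ _ _ _ ⟩
      σ u * u * 1# + σ u * u * (- z)
        ≈⟨ +-cong (*-identityʳ _) (sym (-‿distribʳ-* _ _)) ⟩
      σ u * u + (- (σ u * u * z))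
        ≈⟨ +-congˡ (-‿cong (trans (*-comm _ _) (sym (*-assoc _ _ _)))) ⟩
      σ u * u + (- (z * σ u * u))    ≈⟨ +-congˡ (-‿cong z-σu-u) ⟩
      σ u * u + (- σ (b / d))        ∎

  M-nonzero : ∀ k → ¬ M k ≈ 0#
  M-nonzero zero    = 0≉1 ∘ sym
  M-nonzero (suc k) = *-nonzero _ _ (M-nonzero k) (iter-nonzero k)
    where
    iter-nonzero : ∀ k → ¬ iter k σ u ≈ 0#
    iter-nonzero zero    = *-nonzero _ _ c≉0 (⁻¹-nonzero d≉0)
    iter-nonzero (suc k) = σ-nonzero _ (iter-nonzero k)

  -- Remainder 1 for σⁿ and the conditions on H.

  Identity : ℕ → Set ℓ
  Identity n = A n ≈ 1# × B n ≈ 0# × C n ≈ 0#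

  -- Here `n = 2 + k`, which avoids truncated subtraction.
  HConditions : ℕ → Set ℓ
  HConditions k = H (1 ℕ.+ k) ≈ 0# × H k ≈ 0# × H (2 ℕ.+ k) * M (2 ℕ.+ k) ≈ 1#

  x*σ-zero : ∀ x {y} → y ≈ 0# → x * σ y ≈ 0#
  x*σ-zero x y≈0 = trans (*-congˡ (σ-cong y≈0)) (x*σ0≈0 x)

  drop : ∀ {x y e} → y ≈ 0# → e ≈ x + y → e ≈ x
  drop y≈0 e≈ = trans e≈ (trans (+-congˡ y≈0) (+-identityʳ _))

  -- If `σⁿ` has remainder 1, then `σⁿ⁺¹` and `σⁿ⁺²` have remainders `σ` and `σ²`. So `C` takes the
  -- values 0, 0, 1 from `n` on, and these are nonzero partial norms times `H (n - 2)`, `H (n - 1)`,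
  -- `H n`.
  identity⇒H : ∀ k → Identity (2 ℕ.+ k) → HConditions k
  identity⇒H k (A≈1 , B≈0 , C≈0) =
    H≈0 (1 ℕ.+ k) C′≈0 , H≈0 k C≈0 ,
    trans (*-comm _ _) (trans (sym (C≈M*H (2 ℕ.+ k))) (trans (drop (x*σ-zero γ C′≈0) (C-suc (3 ℕ.+ k)))
      (trans (σ-cong B′≈1) σ-1)))
    where
    H≈0 : ∀ i → C (2 ℕ.+ i) ≈ 0# → H i ≈ 0#
    H≈0 i e = *-zeroˡ-reflecting (H i) (M i) (M-nonzero i)
      (trans (*-comm _ _) (trans (sym (C≈M*H i)) e))

    C′≈0 : C (3 ℕ.+ k) ≈ 0#
    C′≈0 = trans (drop (x*σ-zero γ C≈0) (C-suc (2 ℕ.+ k))) (trans (σ-cong B≈0) σ-0)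

    B′≈1 : B (3 ℕ.+ k) ≈ 1#
    B′≈1 = trans (drop (x*σ-zero β C≈0) (B-suc (2 ℕ.+ k))) (trans (σ-cong A≈1) σ-1)

  -- The same chain backwards: the values 0, 0, 1 of `C` determine `B n` and `B (n + 1)`, and the
  -- latter `A n`, each time by injectivity of `σ`.
  H⇒identity : ∀ k → HConditions k → Identity (2 ℕ.+ k)
  H⇒identity k (H₁≈0 , H₀≈0 , HM≈1) = A≈1 , B≈0 , C≈0
    where
    C≈0 : C (2 ℕ.+ k) ≈ 0#
    C≈0 = trans (C≈M*H k) (trans (*-congˡ H₀≈0) (zeroʳ _))

    C′≈0 : C (3 ℕ.+ k) ≈ 0#
    C′≈0 = trans (C≈M*H (1 ℕ.+ k)) (trans (*-congˡ H₁≈0) (zeroʳ _))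

    C″≈1 : C (4 ℕ.+ k) ≈ 1#
    C″≈1 = trans (C≈M*H (2 ℕ.+ k)) (trans (*-comm _ _) HM≈1)

    B≈0 : B (2 ℕ.+ k) ≈ 0#
    B≈0 = σ-inj _ _ (trans (sym (drop (x*σ-zero γ C≈0) (C-suc (2 ℕ.+ k))))
      (trans C′≈0 (sym σ-0)))

    B′≈1 : B (3 ℕ.+ k) ≈ 1#
    B′≈1 = σ-inj _ _ (trans (sym (drop (x*σ-zero γ C′≈0) (C-suc (3 ℕ.+ k))))
      (trans C″≈1 (sym σ-1)))

    A≈1 : A (2 ℕ.+ k) ≈ 1#
    A≈1 = σ-inj _ _ (trans (sym (drop (x*σ-zero β C≈0) (B-suc (2 ℕ.+ k))))
      (trans B′≈1 (sym σ-1)))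

-- The equivalence over a field with qⁿ elements.

primePower⇒2≤ : ∀ {q} → IsPrimePower q → 2 ≤ q
primePower⇒2≤ (p , k , p-prime , 1≤k , ≡.refl) = ℕₚ.≤-trans 2≤p
  (≡.subst (_≤ p ^ k) (ℕₚ.*-identityʳ p)
    (ℕₚ.^-monoʳ-≤ p {{ℕ.>-nonZero (ℕₚ.<-trans (s≤s z≤n) 2≤p)}} 1≤k))
  where
  2≤p : 2 ≤ p
  2≤p = ℕ.nonTrivial⇒n>1 p {{prime⇒nonTrivial p-prime}}

module Main {r ℓ : Level} (R : CommutativeRing r ℓ)
            (_≟_ : Decidable (CommutativeRing._≈_ R)) (isField : IsField R)
            (q m : ℕ) (2≤q : 2 ≤ q)
            (card : HasCardinality R (q ^ (3 ℕ.+ m)))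
            (σ : CommutativeRing.Carrier R → CommutativeRing.Carrier R)
            (gal : IsGaloisGenerator R q (3 ℕ.+ m) σ)
            (a b c d : CommutativeRing.Carrier R)
            (abcd≉0 : ¬ (CommutativeRing._≈_ R
              (CommutativeRing._*_ R (CommutativeRing._*_ R (CommutativeRing._*_ R a b) c) d)
              (CommutativeRing.0# R))) where
  open CommutativeRing R
  open IsField isField
  open HasCardinality card using (enum)
  open IsGaloisGenerator gal
  open Semilinear R _≟_ isField σ automorphism
  open Reduction R _≟_ isField σ automorphism a b c d abcd≉0
  open Counting R _≟_ card
  open RootCounting card
  open Quadrinomial R _⁻¹ σ a b c d
  open Algebra.Properties.Ring ring using (+-identityˡ-unique; x∙y⁻¹≈ε⇒x≈y)
  open Algebra.Solver.Ring.NaturalCoefficients.Default commutativeSemiring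
    using (solve; _:=_; _:+_; _:*_)
  open Relation.Binary.Reasoning.Setoid setoid

  n : ℕ
  n = 3 ℕ.+ m

  instance
    q-nonZero : ℕ.NonZero q
    q-nonZero = ℕ.>-nonZero (ℕₚ.<-trans (s≤s z≤n) 2≤q)

  Q≤q : Q ≤ q
  Q≤q = ℕₚ.≮⇒≥ λ q<Q → ℕₚ.<⇒≱ (ℕₚ.^-monoˡ-< n q<Q) (Qⁿ≤N n order-exact)

  roots-≤q^ : ∀ {k} (P : SkewPoly k) → roots P ≤ q ^ k
  roots-≤q^ {k} P = ℕₚ.≤-trans (roots-≤ P) (ℕₚ.^-monoˡ-≤ k Q≤q)

  Lₚ : SkewPoly 3
  Lₚ = a ∷ b ∷ c ∷ lead d d≉0

  L≈ : ∀ x → eval Lₚ x ≈ L x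
  L≈ x = trans (sym (+-assoc _ _ _)) (sym (+-assoc _ _ _))

  countFin≡roots : countFin R (λ x → L x ≟ 0#) (q ^ n) enum ≡ roots Lₚ
  countFin≡roots = ≡.trans (countFin≡sum (ker? L) (q ^ n) enum) (ℕₚ.≤-antisym
    (#-mono (ker? L) (ker? (eval Lₚ)) λ x → trans (L≈ x))
    (#-mono (ker? (eval Lₚ)) (ker? L) λ x → trans (sym (L≈ x))))

  P : SkewPoly m
  P = proj₁ (σ-power-reduce m)

  x-reduce : ∀ x → x ≈ eval P (L x) + (A n * x + B n * iter 1 σ x + C n * iter 2 σ x)
  x-reduce x = trans (sym (order-n x)) (proj₂ (σ-power-reduce m) x)

  -- Here σⁿ - 1 = P ∘ L vanishes on F, so L maps F into the roots of P.
  identity⇒q³ : Identity n → roots Lₚ ≡ q ^ 3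
  identity⇒q³ (A≈1 , B≈0 , C≈0) = ℕₚ.≤-antisym (roots-≤q^ Lₚ)
    -- Counting the whole field along `L` gives `q³ qᵐ ≤ roots Lₚ · roots P ≤ roots Lₚ ·
    -- qᵐ`, from which `qᵐ` is cancelled.
    (ℕₚ.*-cancelʳ-≤ (q ^ 3) (roots Lₚ) (q ^ m) {{ℕₚ.m^n≢0 q m}}
      (≡.subst (_≤ roots Lₚ ℕ.* q ^ m) (ℕₚ.^-distribˡ-+-* q 3 m)
        (ℕₚ.≤-trans (#-all all? (λ _ → tt)) (ℕₚ.≤-trans
          (#-ker-≤ (eval-additive Lₚ) all? (ker? (eval P)) (ker-resp (eval-additive P))
            λ x _ → trans (eval-cong P (L≈ x)) (P∘L≈0 x))
          (ℕₚ.*-monoʳ-≤ (roots Lₚ) (roots-≤q^ P))))))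
    where
    all? : U.Decidable (λ (x : Carrier) → ⊤)
    all? _ = yes tt

    P∘L≈0 : ∀ x → eval P (L x) ≈ 0#
    P∘L≈0 x = +-identityˡ-unique _ x (begin
      eval P (L x) + x
        ≈⟨ +-congˡ (sym (trans (+-cong (trans (+-cong (trans (*-congʳ A≈1) (*-identityˡ x))
             (trans (*-congʳ B≈0) (zeroˡ _))) (+-identityʳ _))
             (trans (*-congʳ C≈0) (zeroˡ _))) (+-identityʳ _))) ⟩
      eval P (L x) + (A n * x + B n * iter 1 σ x + C n * iter 2 σ x)   ≈⟨ x-reduce x ⟨
      x                                                                ∎)

  -- The roots of L are roots of (A n - 1) + B n σ + C n σ², which has too small a
  -- degree to vanish on q³ elements unless it is zero.
  q³⇒identity : roots Lₚ ≡ q ^ 3 → Identity n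
  q³⇒identity #≡q³ = x∙y⁻¹≈ε⇒x≈y _ _ A-1≈0 , B≈0 , C≈0
    where
    too-small : ∀ {k} (S : SkewPoly k) → k ≤ 2 → ¬ (∀ x → eval Lₚ x ≈ 0# → eval S x ≈ 0#)
    too-small {k} S k≤2 L⊆S = ℕₚ.<⇒≱ (ℕₚ.^-monoʳ-< q 2≤q (s≤s k≤2))
      (≡.subst (_≤ q ^ k) #≡q³ (ℕₚ.≤-trans
        (#-mono (ker? (eval Lₚ)) (ker? (eval S)) L⊆S) (roots-≤q^ S)))

    vanishes : ∀ x → eval Lₚ x ≈ 0# →
               (A n - 1#) * x + (B n * iter 1 σ x + C n * iter 2 σ x) ≈ 0#
    vanishes x Lx≈0 = +-identityˡ-unique _ x (begin
      ((A n - 1#) * x + (B n * iter 1 σ x + C n * iter 2 σ x)) + x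
        ≈⟨ +-congˡ (*-identityˡ x) ⟨
      ((A n - 1#) * x + (B n * iter 1 σ x + C n * iter 2 σ x)) + 1# * x
        ≈⟨ solve 6 (λ A ν ι x y z → ((A :+ ν) :* x :+ (y :+ z)) :+ ι :* x
             := (ι :+ ν) :* x :+ (A :* x :+ y :+ z)) refl (A n) (- 1#) 1# x _ _ ⟩
      (1# - 1#) * x + (A n * x + B n * iter 1 σ x + C n * iter 2 σ x)
        ≈⟨ +-congʳ (trans (trans (*-congʳ (-‿inverseʳ 1#)) (zeroˡ x)) (sym P∘L≈0)) ⟩
      eval P (L x) + (A n * x + B n * iter 1 σ x + C n * iter 2 σ x)
        ≈⟨ x-reduce x ⟨
      x ∎)
      where
      P∘L≈0 : eval P (L x) ≈ 0#
      P∘L≈0 = trans (eval-cong P (trans (sym (L≈ x)) Lx≈0)) (eval-0 P)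

    C≈0 : C n ≈ 0#
    -- A `SkewPoly` needs a nonzero leading coefficient, so the coefficients are shown to vanish
    -- from the top down, each using the vanishing of the higher ones.
    C≈0 with C n ≟ 0#
    ... | yes e = e
    ... | no C≉0 = contradiction vanishes
      (too-small ((A n - 1#) ∷ B n ∷ lead (C n) C≉0) (s≤s (s≤s z≤n)))

    vanishes₁ : ∀ x → eval Lₚ x ≈ 0# → (A n - 1#) * x + B n * iter 1 σ x ≈ 0#
    vanishes₁ x Lx≈0 = trans (+-congˡ (sym (drop (trans (*-congʳ C≈0) (zeroˡ _)) refl)))
      (vanishes x Lx≈0)

    B≈0 : B n ≈ 0#
    B≈0 with B n ≟ 0#
    ... | yes e = e
    ... | no B≉0 = contradiction vanishes₁
      (too-small ((A n - 1#) ∷ lead (B n) B≉0) (s≤s z≤n))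

    A-1≈0 : A n - 1# ≈ 0#
    A-1≈0 with (A n - 1#) ≟ 0#
    ... | yes e = e
    ... | no A-1≉0 = contradiction
      (λ x Lx≈0 → trans (sym (drop (trans (*-congʳ B≈0) (zeroˡ _)) refl)) (vanishes₁ x Lx≈0))
      (too-small (lead (A n - 1#) A-1≉0) z≤n)

theorem14 : ∀ {r ℓ : Level} (R : CommutativeRing r ℓ) →
  let open CommutativeRing R in
  (_≟_ : Decidable _≈_) →
  (isField : IsField R) →
  (q n : ℕ) → IsPrimePower q → 3 ≤ n →
  (card : HasCardinality R (q ^ n)) →
  (σ : Carrier → Carrier) → IsGaloisGenerator R q n σ →
  (a b c d : Carrier) → ¬ (a * b * c * d ≈ 0#) →
  let open IsField isField using (_⁻¹)
      open HasCardinality card using (enum)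
      open Quadrinomial R _⁻¹ σ a b c d
  in
  (countFin R (λ x → L x ≟ 0#) (q ^ n) enum ≡ q ^ 3)
    ⇔ ((H (n ∸ 1) ≈ 0#) × (H (n ∸ 2) ≈ 0#) × (H n * Norm n (c / d) ≈ 1#))
theorem14 R _≟_ isField q _ q-primePower (s≤s (s≤s (s≤s (z≤n {m})))) card σ gal a b c d abcd≉0 =
  -- Matching on `3 ≤ n` gives `n = 3 + m`, that is `2 + k` with `k = suc m`.
  mk⇔ (λ #≡q³ → identity⇒H (suc m) (q³⇒identity (≡.trans (≡.sym countFin≡roots) #≡q³)))
      (λ hs → ≡.trans countFin≡roots (identity⇒q³ (H⇒identity (suc m) hs)))
  where
  open Main R _≟_ isField q m (primePower⇒2≤ q-primePower) card σ gal a b c d abcd≉0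
  open Semilinear R _≟_ isField σ (IsGaloisGenerator.automorphism gal)
  open Reduction R _≟_ isField σ (IsGaloisGenerator.automorphism gal) a b c d abcd≉0
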